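{- Let $t\neq 0$, and let $F_n^{(a)}(q)$ ($n\ge 0$) be the $q$-Fibonacci numbers with parameter $a$. For every integer $n\ge 0$, $$\sum_{k=0}^n \frac{(-1)^k}{t^k}\, q^{ -ak}q^{ -\binom{k+1}{2}} \left( F^{(a)}_{k+2}(q) +(t-1)q^{a+k}F^{(a)}_{k}(q) \right) = \frac{(-1)^n}{t^n}q^{ -na}q^{ -\binom{n+1}{2}}F^{(a)}_{n+1}(q).$$
   Context: The $q$-Fibonacci numbers with parameter $a$ are defined by $F_0^{(a)}(q)=0$, $F_1^{(a)}(q)=1$, and $F_{n+2}^{(a)}(q) = F_{n+1}^{(a)}(q) + q^{a+n} F_n^{(a)}(q)$ for $n\ge 0$. Here $q$ is a nonzero complex number (or an indeterminate), $q^{a+m}$ means $q^a\cdot q^m$ for a fixed nonzero value $q^a$, and $q^{ -ak}=(q^a)^{ -k}$. $t$ is an indeterminate, which may be specialized to any nonzero complex number. -}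

module Defs where

open import Algebra.Apartness.Bundles using (HeytingField; HeytingCommutativeRing)
open import Algebra.Bundles using (CommutativeRing)
open import Data.Nat.Base using (ℕ; zero; suc)
open import Data.Product.Base using (proj₁)

-- The identity is stated over an arbitrary Heyting field K, where "nonzero"
-- means apart from 0#.  This covers complex numbers as well as indeterminates
-- (take K to be a field of rational functions).
module QFib {c ℓ₁ ℓ₂} (K : HeytingField c ℓ₁ ℓ₂) where

  open HeytingField K public
    using (Carrier; _≈_; _#_; _+_; _*_; -_; _-_; 0#; 1#; #⇒invertible)

  commutativeRing : CommutativeRing c ℓ₁
  commutativeRing = HeytingCommutativeRing.commutativeRing (HeytingField.heytingCommutativeRing K)

  open CommutativeRing commutativeRing using (semiring; +-commutativeMonoid)
  open import Algebra.Properties.Semiring.Exp semiring public using (_^_)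
  open import Algebra.Properties.CommutativeMonoid.Sum +-commutativeMonoid public
    using (sum; sum-syntax; sum⁺-syntax)

  -- #⇒invertible inverts x - 0#, which is ≈ x.
  -- The negative power x⁻ⁿ is written inv x#0 ^ n.
  inv : {x : Carrier} → x # 0# → Carrier
  inv x#0 = proj₁ (#⇒invertible x#0)

  -- The parameter a enters only through the value qᵃ of q to the power a,
  -- with q to the power a + n being qᵃ * q ^ n.
  F : (qᵃ q : Carrier) → ℕ → Carrier
  F qᵃ q zero          = 0#
  F qᵃ q (suc zero)    = 1#
  F qᵃ q (suc (suc n)) = F qᵃ q (suc n) + (qᵃ * q ^ n) * F qᵃ q n

{-# OPTIONS --safe #-}

-- Write cₖ for the coefficient (-1)ᵏ t⁻ᵏ q⁻ᵃᵏ q^-(k+1 choose 2).  The Fibonacci recurrence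
-- turns the k-th summand into cₖ (Fₖ₊₁ + t qᵃ⁺ᵏ Fₖ), and cₖ₊₁ t qᵃ⁺ᵏ⁺¹ = - cₖ, so the sum
-- telescopes: the (k+1)-st summand equals cₖ₊₁ Fₖ₊₂ - cₖ Fₖ₊₁.

module Submission where

open import Defs
open import Algebra.Apartness.Bundles using (HeytingField)
open import Algebra.Bundles using (CommutativeRing)
open import Data.Fin.Base using (toℕ)
open import Data.Nat.Base as ℕ using (ℕ; zero; suc)
open import Data.Nat.Combinatorics using (_C_; nC1≡n; nCk+nC[k+1]≡[n+1]C[k+1])
import Data.Nat.Properties as ℕ
open import Data.Product.Base using (proj₁; proj₂)
open import Function.Base using (_∘_)
open import Relation.Binary.PropositionalEquality as ≡ using (_≡_)

[1+n]C2≡n+nC2 : ∀ n → suc n C 2 ≡ n ℕ.+ n C 2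
[1+n]C2≡n+nC2 n =
  ≡.trans (≡.sym (nCk+nC[k+1]≡[n+1]C[k+1] n 1)) (≡.cong (ℕ._+ n C 2) (nC1≡n n))

module _ {c ℓ₁ ℓ₂} (K : HeytingField c ℓ₁ ℓ₂) where

  open QFib K
  open CommutativeRing commutativeRing
    hiding (Carrier; _≈_; _+_; _*_; -_; _-_; 0#; 1#)
  open import Algebra.Properties.Ring ring using (-1*x≈-x; //-rightDividesˡ)
  open import Algebra.Properties.Semiring.Exp semiring using (^-congʳ; ^-homo-*)
  open import Algebra.Properties.CommutativeSemigroup *-commutativeSemigroup using (interchange)
  open import Algebra.Solver.Ring.NaturalCoefficients.Default commutativeSemiring
    using (solve; _:=_; _:+_; _:*_; con)
  open import Relation.Binary.Reasoning.Setoid setoid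

  -- `∑` unfolds from its first term, so the induction absorbs `f 1` into `g 0` and then shifts both
  -- sequences by one instead of peeling off the last term.
  telescope : (f g : ℕ → Carrier) → (∀ k → g k + f (suc k) ≈ g (suc k)) →
              ∀ n → g 0 + ∑[ i < n ] f (suc (toℕ i)) ≈ g n
  telescope f g step zero    = +-identityʳ (g 0)
  telescope f g step (suc n) = begin
    g 0 + (f 1 + ∑[ i < n ] f (suc (suc (toℕ i))))  ≈⟨ +-assoc _ _ _ ⟨
    g 0 + f 1 + ∑[ i < n ] f (suc (suc (toℕ i)))    ≈⟨ +-congʳ (step 0) ⟩
    g 1 + ∑[ i < n ] f (suc (suc (toℕ i)))          ≈⟨ telescope (f ∘ suc) (g ∘ suc) (step ∘ suc) n ⟩
    g (suc n)                                       ∎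

  ^-inverse : ∀ {x y} → x * y ≈ 1# → ∀ n → x ^ n * y ^ n ≈ 1#
  ^-inverse         xy≈1 zero    = *-identityˡ 1#
  ^-inverse {x} {y} xy≈1 (suc n) = begin
    (x * x ^ n) * (y * y ^ n)  ≈⟨ interchange _ _ _ _ ⟩
    (x * y) * (x ^ n * y ^ n)  ≈⟨ *-cong xy≈1 (^-inverse xy≈1 n) ⟩
    1# * 1#                    ≈⟨ *-identityˡ 1# ⟩
    1#                         ∎

  inv-inverseˡ : ∀ {x} (x#0 : x # 0#) → inv x#0 * x ≈ 1#
  inv-inverseˡ {x} x#0 = begin
    inv x#0 * x              ≈⟨ *-congˡ (//-rightDividesˡ 0# x) ⟨
    inv x#0 * (x - 0# + 0#)  ≈⟨ *-congˡ (+-identityʳ _) ⟩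
    inv x#0 * (x - 0#)       ≈⟨ proj₁ (proj₂ (#⇒invertible x#0)) ⟩
    1#                       ∎

  module _ {q qᵃ t : Carrier} (q#0 : q # 0#) (qᵃ#0 : qᵃ # 0#) (t#0 : t # 0#) where

    -- Factors and bracketing follow the theorem's summand, so that `summand` and `partialSum` agree
    -- with its two sides by unfolding alone.
    coeff : ℕ → Carrier
    coeff k = ((- 1#) ^ k * inv t#0 ^ k) * inv qᵃ#0 ^ k * inv q#0 ^ ((k ℕ.+ 1) C 2)

    summand : ℕ → Carrier
    summand k = coeff k * (F qᵃ q (k ℕ.+ 2) + (t - 1#) * (qᵃ * q ^ k) * F qᵃ q k)

    partialSum : ℕ → Carrier
    partialSum k = coeff k * F qᵃ q (k ℕ.+ 1)

    -- The recurrence releases one copy of `qᵃ * q ^ k * F qᵃ q k`, which turns the factor `t - 1#`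
    -- into `t`.
    F-combine : ∀ k → F qᵃ q (k ℕ.+ 2) + (t - 1#) * (qᵃ * q ^ k) * F qᵃ q k
                    ≈ F qᵃ q (k ℕ.+ 1) + t * (qᵃ * q ^ k) * F qᵃ q k
    F-combine k = begin
      -- `F` only unfolds on an index of the form `suc (suc k)`, and `k ℕ.+ 2` does not reduce to
      -- it.
      F qᵃ q (k ℕ.+ 2) + (t - 1#) * x * f₀  ≡⟨ ≡.cong (λ m → F qᵃ q m + (t - 1#) * x * f₀) (ℕ.+-comm k 2) ⟩
      f₁ + x * f₀ + (t - 1#) * x * f₀
        -- The semiring solver knows no subtraction: `t - 1#` enters as an atom `s`, and `s + 1` is
        -- simplified afterwards.
        ≈⟨ solve 4 (λ f₁ f₀ s x → (f₁ :+ x :* f₀) :+ s :* x :* f₀ := f₁ :+ (s :+ con 1) :* x :* f₀)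
             refl f₁ f₀ (t - 1#) x ⟩
      f₁ + (t - 1# + 1#) * x * f₀           ≈⟨ +-congˡ (*-congʳ (*-congʳ (//-rightDividesˡ 1# t))) ⟩
      f₁ + t * x * f₀                       ≡⟨ ≡.cong (λ m → F qᵃ q m + t * x * f₀) (ℕ.+-comm 1 k) ⟩
      F qᵃ q (k ℕ.+ 1) + t * x * f₀         ∎
      where
      x  = qᵃ * q ^ k
      f₀ = F qᵃ q k
      f₁ = F qᵃ q (suc k)

    -- Pascal's rule splits the exponent: (k+2 choose 2) = (k+1) + (k+1 choose 2).
    inv-q^[1+k]C2 : ∀ k → inv q#0 ^ ((suc k ℕ.+ 1) C 2) ≈ inv q#0 ^ suc k * inv q#0 ^ ((k ℕ.+ 1) C 2)
    inv-q^[1+k]C2 k = begin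
      inv q#0 ^ ((suc k ℕ.+ 1) C 2)                      ≈⟨ ^-congʳ (inv q#0) ([1+n]C2≡n+nC2 (k ℕ.+ 1)) ⟩
      inv q#0 ^ ((k ℕ.+ 1) ℕ.+ (k ℕ.+ 1) C 2)            ≈⟨ ^-homo-* (inv q#0) (k ℕ.+ 1) _ ⟩
      inv q#0 ^ (k ℕ.+ 1) * inv q#0 ^ ((k ℕ.+ 1) C 2)    ≈⟨ *-congʳ (^-congʳ (inv q#0) (ℕ.+-comm k 1)) ⟩
      inv q#0 ^ suc k * inv q#0 ^ ((k ℕ.+ 1) C 2)        ∎

    -- Going from k to k+1 multiplies the coefficient by -1, 1/t, q^(-a) and q^(-(k+1)); the factor
    -- `t * (qᵃ * q ^ suc k)` cancels all of these but the sign.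
    coeff-suc : ∀ k → coeff (suc k) * (t * (qᵃ * q ^ suc k)) ≈ - coeff k
    coeff-suc k = begin
      coeff (suc k) * (t * (qᵃ * q ^ suc k))
        ≈⟨ *-congʳ (*-congˡ (inv-q^[1+k]C2 k)) ⟩
      ((m * m ^ k) * (t⁻¹ * t⁻¹ ^ k)) * (a⁻¹ * a⁻¹ ^ k) * (q⁻¹ ^ suc k * b) * (t * (qᵃ * q ^ suc k))
        -- Each inverse is moved next to its partner, with `- 1#` and all powers kept as atoms; the
        -- three pairs then cancel one by one.
        ≈⟨ solve 11 (λ m M t⁻¹ T a⁻¹ A Q b t a q →
             ((m :* M) :* (t⁻¹ :* T)) :* (a⁻¹ :* A) :* (Q :* b) :* (t :* (a :* q))
             := (t⁻¹ :* t) :* ((a⁻¹ :* a) :* ((Q :* q) :* (m :* ((M :* T) :* A :* b)))))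
             refl m (m ^ k) t⁻¹ (t⁻¹ ^ k) a⁻¹ (a⁻¹ ^ k) (q⁻¹ ^ suc k) b t qᵃ (q ^ suc k) ⟩
      (t⁻¹ * t) * ((a⁻¹ * qᵃ) * ((q⁻¹ ^ suc k * q ^ suc k) * (m * coeff k)))
        ≈⟨ cancel (inv-inverseˡ t#0) ⟩
      (a⁻¹ * qᵃ) * ((q⁻¹ ^ suc k * q ^ suc k) * (m * coeff k))
        ≈⟨ cancel (inv-inverseˡ qᵃ#0) ⟩
      (q⁻¹ ^ suc k * q ^ suc k) * (m * coeff k)
        ≈⟨ cancel (^-inverse (inv-inverseˡ q#0) (suc k)) ⟩
      m * coeff k
        ≈⟨ -1*x≈-x (coeff k) ⟩
      - coeff k ∎
      where
      m   = - 1#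
      t⁻¹ = inv t#0
      a⁻¹ = inv qᵃ#0
      q⁻¹ = inv q#0
      b   = q⁻¹ ^ ((k ℕ.+ 1) C 2)
      cancel : ∀ {u v} → u ≈ 1# → u * v ≈ v
      cancel {v = v} u≈1 = trans (*-congʳ u≈1) (*-identityˡ v)

    summand-zero : summand 0 ≈ partialSum 0
    summand-zero = *-congˡ (trans (F-combine 0) (trans (+-congˡ (zeroʳ _)) (+-identityʳ 1#)))

    -- Once `F-combine` is applied, both terms on the left contain `F qᵃ q (suc k)`, and its total
    -- coefficient vanishes by `coeff-suc`.
    summand-suc : ∀ k → partialSum k + summand (suc k) ≈ partialSum (suc k)
    summand-suc k = begin
      coeff k * f₁′ + summand (suc k)
        ≈⟨ +-cong (*-congˡ (reflexive (≡.cong (F qᵃ q) (ℕ.+-comm k 1)))) (*-congˡ (F-combine (suc k))) ⟩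
      coeff k * f₁ + coeff (suc k) * (f₂ + t * x * f₁)
        ≈⟨ solve 5 (λ c c′ f₁ f₂ y → c :* f₁ :+ c′ :* (f₂ :+ y :* f₁) := (c :+ c′ :* y) :* f₁ :+ c′ :* f₂)
             refl (coeff k) (coeff (suc k)) f₁ f₂ (t * x) ⟩
      (coeff k + coeff (suc k) * (t * x)) * f₁ + coeff (suc k) * f₂
        ≈⟨ +-congʳ (*-congʳ (trans (+-congˡ (coeff-suc k)) (-‿inverseʳ (coeff k)))) ⟩
      0# * f₁ + coeff (suc k) * f₂
        ≈⟨ trans (+-congʳ (zeroˡ f₁)) (+-identityˡ _) ⟩
      coeff (suc k) * f₂ ∎
      where
      x   = qᵃ * q ^ suc k
      f₁  = F qᵃ q (suc k)
      f₁′ = F qᵃ q (k ℕ.+ 1)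
      f₂  = F qᵃ q (suc k ℕ.+ 1)

mainTheorem11 : ∀ {c ℓ₁ ℓ₂} (K : HeytingField c ℓ₁ ℓ₂) → let open QFib K in
    (q qᵃ t : Carrier) (q#0 : q # 0#) (qᵃ#0 : qᵃ # 0#) (t#0 : t # 0#) (n : ℕ) →
    ∑[ i ≤ n ] (let k = toℕ i in
    (((- 1#) ^ k * inv t#0 ^ k) * inv qᵃ#0 ^ k * inv q#0 ^ ((k ℕ.+ 1) C 2))
    * (F qᵃ q (k ℕ.+ 2) + (t - 1#) * (qᵃ * q ^ k) * F qᵃ q k))
    ≈ ((- 1#) ^ n * inv t#0 ^ n) * inv qᵃ#0 ^ n * inv q#0 ^ ((n ℕ.+ 1) C 2)
    * F qᵃ q (n ℕ.+ 1)
mainTheorem11 K q qᵃ t q#0 qᵃ#0 t#0 n =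
  -- The sum over i ≤ n unfolds to the term at 0 plus the n shifted terms; replacing that first term
  -- by `partialSum 0` gives the left side of `telescope`.
  trans (+-congʳ (summand-zero K q#0 qᵃ#0 t#0))
        (telescope K (summand K q#0 qᵃ#0 t#0) (partialSum K q#0 qᵃ#0 t#0) (summand-suc K q#0 qᵃ#0 t#0) n)
  where open CommutativeRing (QFib.commutativeRing K) using (trans; +-congʳ)
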